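{- There exists an odd unimodular lattice in dimension $41$ (that is, in $\mathbb{R}^{41}$) having minimum norm $4$.
   Context: A (Euclidean) lattice $L$ in dimension $n$ is a full-rank lattice in $\mathbb{R}^n$ with the standard inner product $(x,y)$. It is unimodular if $L=L^*$, where $L^*=\{x\in\mathbb{R}^n \mid (x,y)\in\mathbb{Z} \text{ for all } y\in L\}$ is the dual lattice. The norm of a vector $x$ is $(x,x)$ (not its square root), and the minimum norm of $L$ is the smallest norm among all nonzero vectors of $L$. A unimodular lattice is even if all its vectors have even norm, and odd otherwise. -}

module Defs where

open import Algebra.Bundles using (CommutativeMonoid)
open import Algebra.Bundles.Raw using (RawRing)
import Algebra.Definitions.RawMonoid as RawMonoidSum
import Algebra.Properties.CommutativeSemigroup as CommutativeSemigroupProperties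
open import Data.Integer.Base as ℤ using (ℤ)
open import Data.Nat.Base as ℕ using (ℕ)
import Data.Nat.Properties as ℕ
open import Data.Product.Base using (∃-syntax; Σ-syntax; _×_; _,_)
open import Data.Rational.Base as ℚ using (ℚ; 0ℚ; 1ℚ; ½)
import Data.Rational.Properties as ℚ
open import Data.Vec.Functional using (Vector)
open import Level using (0ℓ)
open import Relation.Binary.PropositionalEquality
open import Relation.Nullary using (¬_)
open import Relation.Unary using (Pred; _∈_; _≐_)

-- Real numbers as Cauchy sequences of rationals.  Real equality is the
-- setoid equality _≈_, not propositional equality of sequences.

Cauchy : (ℕ → ℚ) → Set
Cauchy x = ∀ ε → 0ℚ ℚ.< ε →
  ∃[ N ] ∀ m n → N ℕ.≤ m → N ℕ.≤ n → ℚ.∣ x m ℚ.- x n ∣ ℚ.≤ ε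

private

  module +-Properties = CommutativeSemigroupProperties
    (CommutativeMonoid.commutativeSemigroup ℚ.+-0-commutativeMonoid)
  module *-Properties = CommutativeSemigroupProperties
    (CommutativeMonoid.commutativeSemigroup ℚ.*-1-commutativeMonoid)

  -- Opaque: unfolding these moduli makes later type checking very slow.
  abstract

    0<ε/2 : ∀ {ε} → 0ℚ ℚ.< ε → 0ℚ ℚ.< ε ℚ.* ½
    0<ε/2 {ε} 0<ε = ℚ.positive⁻¹ (ε ℚ.* ½) {{ℚ.pos*pos⇒pos ε {{ℚ.positive 0<ε}} ½}}

    ε/2+ε/2≡ε : ∀ ε → ε ℚ.* ½ ℚ.+ ε ℚ.* ½ ≡ ε
    ε/2+ε/2≡ε ε = trans (sym (ℚ.*-distribˡ-+ ε ½ ½)) (ℚ.*-identityʳ ε)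

    +-diff : ∀ a b c d → (a ℚ.+ b) ℚ.- (c ℚ.+ d) ≡ (a ℚ.- c) ℚ.+ (b ℚ.- d)
    +-diff a b c d = trans (cong (a ℚ.+ b ℚ.+_) (ℚ.neg-distrib-+ c d))
      (+-Properties.interchange a b (ℚ.- c) (ℚ.- d))

    factorˡ : ∀ a b c → a ℚ.* b ℚ.- a ℚ.* c ≡ a ℚ.* (b ℚ.- c)
    factorˡ a b c = trans (cong (a ℚ.* b ℚ.+_) (ℚ.neg-distribʳ-* a c))
      (sym (ℚ.*-distribˡ-+ a b (ℚ.- c)))

    recentre : ∀ a b → a ≡ (a ℚ.- b) ℚ.+ b
    recentre a b = trans (sym (ℚ.+-identityʳ a))
      (trans (cong (a ℚ.+_) (sym (ℚ.+-inverseˡ b))) (sym (ℚ.+-assoc a (ℚ.- b) b)))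

    *-diff : ∀ a b c d → a ℚ.* b ℚ.- c ℚ.* d ≡ a ℚ.* (b ℚ.- d) ℚ.+ d ℚ.* (a ℚ.- c)
    *-diff a b c d = begin
      a ℚ.* b ℚ.- c ℚ.* d
        ≡⟨ cong (ℚ._- c ℚ.* d) (recentre (a ℚ.* b) (a ℚ.* d)) ⟩
      (a ℚ.* b ℚ.- a ℚ.* d) ℚ.+ a ℚ.* d ℚ.- c ℚ.* d
        ≡⟨ ℚ.+-assoc (a ℚ.* b ℚ.- a ℚ.* d) (a ℚ.* d) (ℚ.- (c ℚ.* d)) ⟩
      (a ℚ.* b ℚ.- a ℚ.* d) ℚ.+ (a ℚ.* d ℚ.- c ℚ.* d)
        ≡⟨ cong₂ ℚ._+_ (factorˡ a b d) (trans (cong₂ ℚ._-_ (ℚ.*-comm a d) (ℚ.*-comm c d)) (factorˡ d a c)) ⟩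
      a ℚ.* (b ℚ.- d) ℚ.+ d ℚ.* (a ℚ.- c) ∎
      where open ≡-Reasoning

    const-cauchy : ∀ q → Cauchy (λ _ → q)
    const-cauchy q ε 0<ε = 0 , λ _ _ _ _ →
      subst (ℚ._≤ ε) (sym (cong ℚ.∣_∣ (ℚ.+-inverseʳ q))) (ℚ.<⇒≤ 0<ε)

    +-cauchy : ∀ x y → Cauchy x → Cauchy y → Cauchy (λ n → x n ℚ.+ y n)
    +-cauchy x y cx cy ε 0<ε
      with M , hx ← cx (ε ℚ.* ½) (0<ε/2 0<ε) | N , hy ← cy (ε ℚ.* ½) (0<ε/2 0<ε)
      = M ℕ.⊔ N , λ m n p q → begin
        ℚ.∣ (x m ℚ.+ y m) ℚ.- (x n ℚ.+ y n) ∣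
          ≡⟨ cong ℚ.∣_∣ (+-diff (x m) (y m) (x n) (y n)) ⟩
        ℚ.∣ (x m ℚ.- x n) ℚ.+ (y m ℚ.- y n) ∣
          ≤⟨ ℚ.∣p+q∣≤∣p∣+∣q∣ (x m ℚ.- x n) (y m ℚ.- y n) ⟩
        ℚ.∣ x m ℚ.- x n ∣ ℚ.+ ℚ.∣ y m ℚ.- y n ∣
          ≤⟨ ℚ.+-mono-≤ (hx m n (ℕ.m⊔n≤o⇒m≤o M N p) (ℕ.m⊔n≤o⇒m≤o M N q))
                        (hy m n (ℕ.m⊔n≤o⇒n≤o M N p) (ℕ.m⊔n≤o⇒n≤o M N q)) ⟩
        ε ℚ.* ½ ℚ.+ ε ℚ.* ½
          ≡⟨ ε/2+ε/2≡ε ε ⟩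
        ε ∎
      where open ℚ.≤-Reasoning

    -‿cauchy : ∀ x → Cauchy x → Cauchy (λ n → ℚ.- x n)
    -‿cauchy x cx ε 0<ε with N , h ← cx ε 0<ε
      = N , λ m n p q → subst (ℚ._≤ ε)
          (trans (sym (ℚ.∣-p∣≡∣p∣ (x m ℚ.- x n)))
                 (cong ℚ.∣_∣ (ℚ.neg-distrib-+ (x m) (ℚ.- x n))))
          (h m n p q)

    bounded : ∀ x → Cauchy x →
      ∃[ B ] ℚ.Positive B × ∃[ N ] ∀ n → N ℕ.≤ n → ℚ.∣ x n ∣ ℚ.≤ B
    bounded x cx with N , h ← cx 1ℚ (ℚ.positive⁻¹ 1ℚ)
      = 1ℚ ℚ.+ ℚ.∣ x N ∣
      , ℚ.positive (ℚ.+-mono-<-≤ (ℚ.positive⁻¹ 1ℚ) (ℚ.0≤∣p∣ (x N)))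
      , N , λ n p → begin
        ℚ.∣ x n ∣
          ≡⟨ cong ℚ.∣_∣ (recentre (x n) (x N)) ⟩
        ℚ.∣ (x n ℚ.- x N) ℚ.+ x N ∣
          ≤⟨ ℚ.∣p+q∣≤∣p∣+∣q∣ (x n ℚ.- x N) (x N) ⟩
        ℚ.∣ x n ℚ.- x N ∣ ℚ.+ ℚ.∣ x N ∣
          ≤⟨ ℚ.+-monoˡ-≤ ℚ.∣ x N ∣ (h n N p ℕ.≤-refl) ⟩
        1ℚ ℚ.+ ℚ.∣ x N ∣ ∎
      where open ℚ.≤-Reasoning

    divide : ∀ C → .{{_ : ℚ.Positive C}} → ∀ ε → 0ℚ ℚ.< ε → ∃[ δ ] 0ℚ ℚ.< δ × C ℚ.* δ ≡ ε
    divide C ε 0<ε = ε ℚ.* 1/C , 0<δ , (begin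
        C ℚ.* (ε ℚ.* 1/C)  ≡⟨ *-Properties.x∙yz≈y∙xz C ε 1/C ⟩
        ε ℚ.* (C ℚ.* 1/C)  ≡⟨ cong (ε ℚ.*_) (ℚ.*-inverseʳ C {{C≢0}}) ⟩
        ε ℚ.* 1ℚ           ≡⟨ ℚ.*-identityʳ ε ⟩
        ε                  ∎)
      where
      open ≡-Reasoning
      C≢0 : ℚ.NonZero C
      C≢0 = ℚ.pos⇒nonZero C
      1/C : ℚ
      1/C = ℚ.1/_ C {{C≢0}}
      0<δ : 0ℚ ℚ.< ε ℚ.* 1/C
      0<δ = ℚ.positive⁻¹ (ε ℚ.* 1/C)
        {{ℚ.pos*pos⇒pos ε {{ℚ.positive 0<ε}} 1/C {{ℚ.1/pos⇒pos C}}}}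

    *-mono-≤-abs : ∀ {a b p q} → 0ℚ ℚ.≤ b → ℚ.∣ p ∣ ℚ.≤ a → ℚ.∣ q ∣ ℚ.≤ b →
      ℚ.∣ p ℚ.* q ∣ ℚ.≤ a ℚ.* b
    *-mono-≤-abs {a} {b} {p} {q} 0≤b p≤a q≤b = begin
      ℚ.∣ p ℚ.* q ∣         ≡⟨ ℚ.∣p*q∣≡∣p∣*∣q∣ p q ⟩
      ℚ.∣ p ∣ ℚ.* ℚ.∣ q ∣   ≤⟨ ℚ.*-monoˡ-≤-nonNeg ℚ.∣ p ∣ {{ℚ.∣-∣-nonNeg p}} q≤b ⟩
      ℚ.∣ p ∣ ℚ.* b         ≤⟨ ℚ.*-monoʳ-≤-nonNeg b {{ℚ.nonNegative 0≤b}} p≤a ⟩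
      a ℚ.* b               ∎
      where open ℚ.≤-Reasoning

    *-cauchy : ∀ x y → Cauchy x → Cauchy y → Cauchy (λ n → x n ℚ.* y n)
    *-cauchy x y cx cy ε 0<ε
      with A , A>0 , K , ax ← bounded x cx | B , B>0 , L , by ← bounded y cy
      with δ , 0<δ , Aδ ← divide A {{A>0}} (ε ℚ.* ½) (0<ε/2 0<ε)
         | η , 0<η , Bη ← divide B {{B>0}} (ε ℚ.* ½) (0<ε/2 0<ε)
      with M , hy ← cy δ 0<δ | N , hx ← cx η 0<η
      = (K ℕ.⊔ L) ℕ.⊔ (M ℕ.⊔ N) , λ m n p q →
        let KL≤m = ℕ.m⊔n≤o⇒m≤o (K ℕ.⊔ L) (M ℕ.⊔ N) p
            KL≤n = ℕ.m⊔n≤o⇒m≤o (K ℕ.⊔ L) (M ℕ.⊔ N) q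
            MN≤m = ℕ.m⊔n≤o⇒n≤o (K ℕ.⊔ L) (M ℕ.⊔ N) p
            MN≤n = ℕ.m⊔n≤o⇒n≤o (K ℕ.⊔ L) (M ℕ.⊔ N) q
        in begin
        ℚ.∣ x m ℚ.* y m ℚ.- x n ℚ.* y n ∣
          ≡⟨ cong ℚ.∣_∣ (*-diff (x m) (y m) (x n) (y n)) ⟩
        ℚ.∣ x m ℚ.* (y m ℚ.- y n) ℚ.+ y n ℚ.* (x m ℚ.- x n) ∣
          ≤⟨ ℚ.∣p+q∣≤∣p∣+∣q∣ (x m ℚ.* (y m ℚ.- y n)) (y n ℚ.* (x m ℚ.- x n)) ⟩
        ℚ.∣ x m ℚ.* (y m ℚ.- y n) ∣ ℚ.+ ℚ.∣ y n ℚ.* (x m ℚ.- x n) ∣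
          ≤⟨ ℚ.+-mono-≤
               (*-mono-≤-abs {p = x m} {q = y m ℚ.- y n} (ℚ.<⇒≤ 0<δ)
                 (ax m (ℕ.m⊔n≤o⇒m≤o K L KL≤m))
                 (hy m n (ℕ.m⊔n≤o⇒m≤o M N MN≤m) (ℕ.m⊔n≤o⇒m≤o M N MN≤n)))
               (*-mono-≤-abs {p = y n} {q = x m ℚ.- x n} (ℚ.<⇒≤ 0<η)
                 (by n (ℕ.m⊔n≤o⇒n≤o K L KL≤n))
                 (hx m n (ℕ.m⊔n≤o⇒n≤o M N MN≤m) (ℕ.m⊔n≤o⇒n≤o M N MN≤n))) ⟩
        A ℚ.* δ ℚ.+ B ℚ.* η
          ≡⟨ cong₂ ℚ._+_ Aδ Bη ⟩
        ε ℚ.* ½ ℚ.+ ε ℚ.* ½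
          ≡⟨ ε/2+ε/2≡ε ε ⟩
        ε ∎
      where open ℚ.≤-Reasoning

record ℝ : Set where
  constructor mkℝ
  field
    seq    : ℕ → ℚ
    cauchy : Cauchy seq

open ℝ public

infix 4 _≈_ _≤_

_≈_ : ℝ → ℝ → Set
x ≈ y = ∀ ε → 0ℚ ℚ.< ε →
  ∃[ N ] ∀ n → N ℕ.≤ n → ℚ.∣ seq x n ℚ.- seq y n ∣ ℚ.≤ ε

_≤_ : ℝ → ℝ → Set
x ≤ y = ∀ ε → 0ℚ ℚ.< ε →
  ∃[ N ] ∀ n → N ℕ.≤ n → seq x n ℚ.≤ seq y n ℚ.+ ε

fromℚ : ℚ → ℝ
fromℚ q = mkℝ (λ _ → q) (const-cauchy q)

fromℤ : ℤ → ℝ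
fromℤ k = fromℚ (k ℚ./ 1)

infixl 6 _+_
infixl 7 _*_
infix  8 -_

_+_ : ℝ → ℝ → ℝ
x + y = mkℝ (λ n → seq x n ℚ.+ seq y n) (+-cauchy (seq x) (seq y) (cauchy x) (cauchy y))

_*_ : ℝ → ℝ → ℝ
x * y = mkℝ (λ n → seq x n ℚ.* seq y n) (*-cauchy (seq x) (seq y) (cauchy x) (cauchy y))

-_ : ℝ → ℝ
- x = mkℝ (λ n → ℚ.- seq x n) (-‿cauchy (seq x) (cauchy x))

ℝ-rawRing : RawRing 0ℓ 0ℓ
ℝ-rawRing = record
  { Carrier = ℝ
  ; _≈_ = _≈_
  ; _+_ = _+_
  ; _*_ = _*_
  ; -_  = -_
  ; 0#  = fromℚ 0ℚ
  ; 1#  = fromℚ 1ℚ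
  }

open RawMonoidSum (RawRing.+-rawMonoid ℝ-rawRing) public using (sum)

infix 9 ℝ^_

ℝ^_ : ℕ → Set
ℝ^ n = Vector ℝ n

infix 4 _≋_

_≋_ : ∀ {n} → ℝ^ n → ℝ^ n → Set
x ≋ y = ∀ i → x i ≈ y i

𝟎 : ∀ {n} → ℝ^ n
𝟎 i = fromℚ 0ℚ

⟨_,_⟩ : ∀ {n} → ℝ^ n → ℝ^ n → ℝ
⟨ x , y ⟩ = sum (λ i → x i * y i)

-- By convention ⟨ x , x ⟩ itself, not its square root.
norm : ∀ {n} → ℝ^ n → ℝ
norm x = ⟨ x , x ⟩

combination : ∀ {m n} → Vector ℝ m → Vector (ℝ^ n) m → ℝ^ n
combination c b j = sum (λ i → c i * b i j)

LinearlyIndependent : ∀ {m n} → Vector (ℝ^ n) m → Set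
LinearlyIndependent b = ∀ c → combination c b ≋ 𝟎 → ∀ i → c i ≈ fromℚ 0ℚ

-- A full-rank lattice in ℝ^ n, presented by a ℤ-basis.
record Lattice (n : ℕ) : Set where
  field
    basis       : Vector (ℝ^ n) n
    independent : LinearlyIndependent basis

open Lattice public

Points : ∀ {n} → Lattice n → Pred (ℝ^ n) 0ℓ
Points {n} L x = Σ[ c ∈ Vector ℤ n ] x ≋ combination (λ i → fromℤ (c i)) (basis L)

IsInteger : ℝ → Set
IsInteger r = ∃[ k ] r ≈ fromℤ k

IsEvenInteger : ℝ → Set
IsEvenInteger r = ∃[ k ] r ≈ fromℤ (ℤ.+ 2 ℤ.* k)

Dual : ∀ {n} → Lattice n → Pred (ℝ^ n) 0ℓ
Dual L x = ∀ y → y ∈ Points L → IsInteger ⟨ x , y ⟩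

Unimodular : ∀ {n} → Lattice n → Set
Unimodular L = Points L ≐ Dual L

Even : ∀ {n} → Lattice n → Set
Even L = ∀ x → x ∈ Points L → IsEvenInteger (norm x)

OddUnimodular : ∀ {n} → Lattice n → Set
OddUnimodular L = Unimodular L × ¬ Even L

HasMinimumNorm : ∀ {n} → Lattice n → ℝ → Set
HasMinimumNorm L μ =
  (∃[ x ] x ∈ Points L × ¬ (x ≋ 𝟎) × norm x ≈ μ) ×
  (∀ x → x ∈ Points L → ¬ (x ≋ 𝟎) → μ ≤ norm x)

{-# OPTIONS --safe #-}

-- The lattice is ½C, where C ⊆ ℤ⁴¹ consists of the integer vectors whose reduction modulo 4
-- lies in a self-dual code over ℤ/4.  The residues modulo 2 of C form a binary doubly even
-- [41,10] code of minimum weight 16 whose dual has minimum weight 4.  A nonzero v ∈ C is odd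
-- somewhere, or is 2y with y odd somewhere, or is 4z with z ≠ 0.  In the first case v has at
-- least 16 odd entries; in the second y mod 2 is a nonzero word of the dual binary code, so y
-- has at least 4 odd entries.  Each time v has norm at least 16, and ½v norm at least 4.
-- A generator matrix in the shape [I X Y; 0 2I 2Z; 0 0 4I] exhibits unimodularity: its Gram
-- matrix and that of the dual basis are both divisible by 4.

module Submission where

open import Algebra.Bundles using (CommutativeRing; CommutativeSemiring; Semiring)
import Algebra.Properties.Semiring.Sum as SemiringSum
open import Data.Fin.Base using (Fin; zero; suc)
open import Data.Fin.Properties using (all?)
open import Data.Integer.Base as ℤ using (ℤ; -[1+_]; ∣_∣)
open import Data.Integer.Base using (+_)
open import Data.Integer.Divisibility.Signed
  using (_∣_; divides; quotient; _∣?_; ∣n⇒∣m*n; ∣m∣n⇒∣m+n)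
import Data.Integer.Properties as ℤ
import Data.Integer.Solver as ℤ-Solver
open import Data.List.Base as List using (List)
open import Data.List.Membership.Propositional using () renaming (_∈_ to _∈ˡ_)
open import Data.List.Membership.Propositional.Properties using (∈-++⁺ˡ; ∈-++⁺ʳ; ∈-map⁺)
open import Data.List.Relation.Unary.All as All using (All)
open import Data.List.Relation.Unary.Any using (here)
open import Data.Nat.Base as ℕ using (ℕ; zero; suc; parity; s≤s; z≤n; _/_; _%_)
import Data.Nat.Coprimality as Coprimality
import Data.Nat.Properties as ℕ
open import Data.Parity.Base as ℙ using (Parity; 0ℙ; 1ℙ)
import Data.Parity.Properties as ℙ
open import Data.Product.Base using (Σ; _×_)
open import Data.Product.Base using (_,_; proj₁; proj₂; ∃-syntax)
open import Data.Rational.Base as ℚ using (ℚ; mkℚ; 0ℚ; 1ℚ; ½)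
import Data.Rational.Properties as ℚ
open import Data.Rational.Solver using (module +-*-Solver)
open import Data.Sum.Base as Sum using (_⊎_; inj₁; inj₂; [_,_]′)
open import Data.Vec.Base as Vec using (Vec; []; _∷_; _++_; _∷ʳ_; lookup; map; replicate; tabulate; zipWith)
open import Data.Vec.Properties using
  ( ≡-dec; lookup-zipWith; lookup∘tabulate; lookup-replicate
  ; tabulate∘lookup; tabulate-cong; zipWith-identityʳ )
open import Function.Base using (_∘_)
open import Relation.Binary.Definitions using (tri<; tri≈; tri>)
open import Relation.Nullary using (¬_; contradiction; Dec; yes; no)
open import Relation.Nullary.Decidable using (map′; _×-dec_; _⊎-dec_; ¬?; toWitness)
open import Relation.Unary using (_∈_)

-- Finite sums and Kronecker deltas over a semiring

module FiniteSums {c ℓ} (R : Semiring c ℓ) where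
  open Semiring R hiding (zero)
  open SemiringSum R public
  open import Relation.Binary.Reasoning.Setoid setoid

  δ : ∀ {n} → Fin n → Fin n → Carrier
  δ zero    zero    = 1#
  δ zero    (suc _) = 0#
  δ (suc _) zero    = 0#
  δ (suc i) (suc j) = δ i j

  sum-zero : ∀ {n} (f : Fin n → Carrier) → sum (λ i → f i * 0#) ≈ 0#
  sum-zero {n} f = trans (sum-cong-≋ (λ i → zeroʳ (f i))) (sum-replicate-zero n)

  sum-δ : ∀ {n} (f : Fin n → Carrier) j → sum (λ i → f i * δ i j) ≈ f j
  sum-δ f zero    = trans (+-cong (*-identityʳ (f zero)) (sum-zero (f ∘ suc))) (+-identityʳ _)
  sum-δ f (suc j) = trans (+-cong (zeroʳ (f zero)) (sum-δ (f ∘ suc) j)) (+-identityˡ _)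

  zero-sum : ∀ {n} (f : Fin n → Carrier) → sum (λ i → 0# * f i) ≈ 0#
  zero-sum {n} f = trans (sum-cong-≋ (λ i → zeroˡ (f i))) (sum-replicate-zero n)

  δ-sum : ∀ {n} (f : Fin n → Carrier) i → sum (λ j → δ i j * f j) ≈ f i
  δ-sum f zero    = trans (+-cong (*-identityˡ (f zero)) (zero-sum (f ∘ suc))) (+-identityʳ _)
  δ-sum f (suc i) = trans (+-cong (zeroˡ (f zero)) (δ-sum (f ∘ suc) i)) (+-identityˡ _)

  -- Associativity of row times matrix times column. The later exchanges of double sums over `ℤ` and
  -- `ℚ` rest on it.
  sum-*-assoc : ∀ {m n} (f : Fin m → Carrier) (M : Fin m → Fin n → Carrier) (g : Fin n → Carrier) →
    sum (λ j → sum (λ i → f i * M i j) * g j) ≈ sum (λ i → f i * sum (λ j → M i j * g j))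
  sum-*-assoc f M g = begin
    sum (λ j → sum (λ i → f i * M i j) * g j)
      ≈⟨ sum-cong-≋ (λ j → *-distribʳ-sum (g j) (λ i → f i * M i j)) ⟩
    sum (λ j → sum (λ i → f i * M i j * g j))
      ≈⟨ ∑-comm (λ j i → f i * M i j * g j) ⟩
    sum (λ i → sum (λ j → f i * M i j * g j))
      ≈⟨ sum-cong-≋ (λ i → trans (sum-cong-≋ (λ j → *-assoc (f i) (M i j) (g j)))
           (sym (*-distribˡ-sum (f i) (λ j → M i j * g j)))) ⟩
    sum (λ i → f i * sum (λ j → M i j * g j)) ∎

open import Defs
open import Relation.Binary.PropositionalEquality

module Sumℤ = FiniteSums (CommutativeRing.semiring ℤ.+-*-commutativeRing)
module Sumℚ = FiniteSums (CommutativeRing.semiring ℚ.+-*-commutativeRing)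

-- Integers inside the rationals

ι : ℤ → ℚ
ι k = k ℚ./ 1

-- `k ℚ./ 1` normalises by a gcd and is stuck for a variable `k`. The constructor form exposes
-- numerator and denominator, so that the next lemmas become integer identities.
ι-mkℚ : ∀ k → ι k ≡ mkℚ k 0 (Coprimality.sym (Coprimality.1-coprimeTo ℤ.∣ k ∣))
ι-mkℚ k = ℚ.↥p/↧p≡p (mkℚ k 0 _)

ι-+ : ∀ k l → ι (k ℤ.+ l) ≡ ι k ℚ.+ ι l
ι-+ k l rewrite ι-mkℚ k | ι-mkℚ l =
  cong ι (sym (cong₂ ℤ._+_ (ℤ.*-identityʳ k) (ℤ.*-identityʳ l)))

ι-* : ∀ k l → ι (k ℤ.* l) ≡ ι k ℚ.* ι l
ι-* k l rewrite ι-mkℚ k | ι-mkℚ l = refl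

ι-injective : ∀ {k l} → ι k ≡ ι l → k ≡ l
ι-injective {k} {l} eq =
  trans (sym (cong ℚ.↥_ (ι-mkℚ k))) (trans (cong ℚ.↥_ eq) (cong ℚ.↥_ (ι-mkℚ l)))

ι-mono-≤ : ∀ {k l} → k ℤ.≤ l → ι k ℚ.≤ ι l
ι-mono-≤ {k} {l} k≤l rewrite ι-mkℚ k | ι-mkℚ l =
  ℚ.*≤* (subst₂ ℤ._≤_ (sym (ℤ.*-identityʳ k)) (sym (ℤ.*-identityʳ l)) k≤l)

ι-sum : ∀ {n} (f : Fin n → ℤ) → ι (Sumℤ.sum f) ≡ Sumℚ.sum (λ i → ι (f i))
ι-sum {zero}  f = refl
ι-sum {suc n} f = trans (ι-+ (f zero) _) (cong (ι (f zero) ℚ.+_) (ι-sum (f ∘ suc)))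

ι-δ : ∀ {n} (i j : Fin n) → ι (Sumℤ.δ i j) ≡ Sumℚ.δ i j
ι-δ zero    zero    = refl
ι-δ zero    (suc j) = refl
ι-δ (suc i) zero    = refl
ι-δ (suc i) (suc j) = ι-δ i j

-- Null sequences

-- x ≈ y unfolds to Null (λ n → seq x n - seq y n), so real linear algebra reduces to
-- rational identities for each index n.
Null : (ℕ → ℚ) → Set
Null d = ∀ ε → 0ℚ ℚ.< ε → ∃[ N ] ∀ n → N ℕ.≤ n → ℚ.∣ d n ∣ ℚ.≤ ε

null-cong : ∀ {d e} → d ≗ e → Null d → Null e
null-cong d≗e d→0 ε 0<ε with N , h ← d→0 ε 0<ε =
  N , λ n N≤n → subst (λ q → ℚ.∣ q ∣ ℚ.≤ ε) (d≗e n) (h n N≤n)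

null-0 : Null (λ _ → 0ℚ)
null-0 ε 0<ε = 0 , λ _ _ → ℚ.<⇒≤ 0<ε

null-+ : ∀ {d e} → Null d → Null e → Null (λ n → d n ℚ.+ e n)
null-+ {d} {e} d→0 e→0 ε 0<ε
  with M , hd ← d→0 (ε ℚ.* ½) (ℚ.*-monoˡ-<-pos ½ 0<ε)
     | N , he ← e→0 (ε ℚ.* ½) (ℚ.*-monoˡ-<-pos ½ 0<ε)
  = M ℕ.⊔ N , λ n M⊔N≤n → begin
    ℚ.∣ d n ℚ.+ e n ∣          ≤⟨ ℚ.∣p+q∣≤∣p∣+∣q∣ (d n) (e n) ⟩
    ℚ.∣ d n ∣ ℚ.+ ℚ.∣ e n ∣    ≤⟨ ℚ.+-mono-≤ (hd n (ℕ.m⊔n≤o⇒m≤o M N M⊔N≤n))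
                                            (he n (ℕ.m⊔n≤o⇒n≤o M N M⊔N≤n)) ⟩
    ε ℚ.* ½ ℚ.+ ε ℚ.* ½        ≡⟨ ℚ.*-distribˡ-+ ε ½ ½ ⟨
    ε ℚ.* 1ℚ                   ≡⟨ ℚ.*-identityʳ ε ⟩
    ε                          ∎
  where open ℚ.≤-Reasoning

null-* : ∀ {d e} → Null d → Null e → Null (λ n → d n ℚ.* e n)
null-* {d} {e} d→0 e→0 ε 0<ε
  with M , hd ← d→0 1ℚ (ℚ.positive⁻¹ 1ℚ) | N , he ← e→0 ε 0<ε
  = M ℕ.⊔ N , λ n M⊔N≤n → begin
    ℚ.∣ d n ℚ.* e n ∣          ≡⟨ ℚ.∣p*q∣≡∣p∣*∣q∣ (d n) (e n) ⟩
    ℚ.∣ d n ∣ ℚ.* ℚ.∣ e n ∣    ≤⟨ ℚ.*-monoʳ-≤-nonNeg ℚ.∣ e n ∣ {{ℚ.∣-∣-nonNeg (e n)}}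
                                   (hd n (ℕ.m⊔n≤o⇒m≤o M N M⊔N≤n)) ⟩
    1ℚ ℚ.* ℚ.∣ e n ∣           ≡⟨ ℚ.*-identityˡ ℚ.∣ e n ∣ ⟩
    ℚ.∣ e n ∣                  ≤⟨ he n (ℕ.m⊔n≤o⇒n≤o M N M⊔N≤n) ⟩
    ε                          ∎
  where open ℚ.≤-Reasoning

null-*ˡ : ∀ {d} q → Null d → Null (λ n → q ℚ.* d n)
null-*ˡ {d} q d→0 ε 0<ε = proj₁ (d→0 (ε ℚ.* 1/b) 0<ε/b) , λ n N≤n → begin
    ℚ.∣ q ℚ.* d n ∣            ≡⟨ ℚ.∣p*q∣≡∣p∣*∣q∣ q (d n) ⟩
    ℚ.∣ q ∣ ℚ.* ℚ.∣ d n ∣      ≤⟨ ℚ.*-monoʳ-≤-nonNeg ℚ.∣ d n ∣ {{ℚ.∣-∣-nonNeg (d n)}}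
                                   (subst (ℚ._≤ b) (ℚ.+-identityˡ ℚ.∣ q ∣)
                                     (ℚ.+-monoˡ-≤ ℚ.∣ q ∣ (ℚ.<⇒≤ (ℚ.positive⁻¹ 1ℚ)))) ⟩
    b ℚ.* ℚ.∣ d n ∣            ≤⟨ ℚ.*-monoˡ-≤-nonNeg b {{ℚ.pos⇒nonNeg b {{b>0}}}}
                                   (proj₂ (d→0 (ε ℚ.* 1/b) 0<ε/b) n N≤n) ⟩
    b ℚ.* (ε ℚ.* 1/b)          ≡⟨ solve 3 (λ b ε c → b :* (ε :* c) := ε :* (b :* c)) refl b ε 1/b ⟩
    ε ℚ.* (b ℚ.* 1/b)          ≡⟨ cong (ε ℚ.*_) (ℚ.*-inverseʳ b {{b≢0}}) ⟩
    ε ℚ.* 1ℚ                   ≡⟨ ℚ.*-identityʳ ε ⟩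
    ε                          ∎
  where
  open ℚ.≤-Reasoning
  open +-*-Solver
  b : ℚ
  -- The summand `1ℚ` keeps the bound invertible even for `q` zero.
  b = 1ℚ ℚ.+ ℚ.∣ q ∣
  b>0 : ℚ.Positive b
  b>0 = ℚ.pos+nonNeg⇒pos 1ℚ ℚ.∣ q ∣ {{ℚ.∣-∣-nonNeg q}}
  b≢0 : ℚ.NonZero b
  b≢0 = ℚ.pos⇒nonZero b {{b>0}}
  1/b : ℚ
  1/b = ℚ.1/_ b {{b≢0}}
  0<ε/b : 0ℚ ℚ.< ε ℚ.* 1/b
  0<ε/b = ℚ.positive⁻¹ (ε ℚ.* 1/b) {{ℚ.pos*pos⇒pos ε {{ℚ.positive 0<ε}} 1/b {{ℚ.1/pos⇒pos b {{b>0}}}}}}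

null-sum : ∀ {m} {f : Fin m → ℕ → ℚ} → (∀ i → Null (f i)) → Null (λ n → Sumℚ.sum (λ i → f i n))
null-sum {zero}  h = null-0
null-sum {suc m} h = null-+ (h zero) (null-sum (h ∘ suc))

-- If `∣ q ∣` were positive, density would give an `ε` strictly between `0ℚ` and `∣ q ∣`, against
-- the eventual bound by `ε`.
null-const : ∀ {q} → Null (λ _ → q) → q ≡ 0ℚ
null-const {q} h with ℚ.<-cmp 0ℚ ℚ.∣ q ∣
... | tri≈ _ 0≡∣q∣ _ = ℚ.∣p∣≡0⇒p≡0 q (sym 0≡∣q∣)
... | tri> _ _ ∣q∣<0 = contradiction (ℚ.≤-<-trans (ℚ.0≤∣p∣ q) ∣q∣<0) (ℚ.<-irrefl refl)
... | tri< 0<∣q∣ _ _ with ε , 0<ε , ε<∣q∣ ← ℚ.<-dense 0<∣q∣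
  with N , ∣q∣≤ε ← h ε 0<ε = contradiction (ℚ.≤-<-trans (∣q∣≤ε N ℕ.≤-refl) ε<∣q∣) (ℚ.<-irrefl refl)

-- Transfer between real and rational relations

fromℚ-injective : ∀ {p q} → fromℚ p ≈ fromℚ q → p ≡ q
fromℚ-injective {p} {q} h = begin
  p                  ≡⟨ solve 2 (λ p q → p := (p :- q) :+ q) refl p q ⟩
  (p ℚ.- q) ℚ.+ q    ≡⟨ cong (ℚ._+ q) (null-const h) ⟩
  0ℚ ℚ.+ q           ≡⟨ ℚ.+-identityˡ q ⟩
  q                  ∎
  where
  open ≡-Reasoning
  open +-*-Solver

seq-sum : ∀ {m} (f : Fin m → ℝ) n → seq (sum f) n ≡ Sumℚ.sum (λ i → seq (f i) n)
seq-sum {zero}  f n = refl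
seq-sum {suc m} f n = cong (seq (f zero) n ℚ.+_) (seq-sum (f ∘ suc) n)

≈-sym : ∀ {x y} → x ≈ y → y ≈ x
≈-sym {x} {y} x≈y ε 0<ε with N , h ← x≈y ε 0<ε = N , λ n N≤n →
  subst (ℚ._≤ ε) (trans (sym (ℚ.∣-p∣≡∣p∣ (seq x n ℚ.- seq y n)))
    (cong ℚ.∣_∣ (solve 2 (λ p q → :- (p :- q) := q :- p) refl (seq x n) (seq y n)))) (h n N≤n)
  where open +-*-Solver

≈-trans : ∀ {x y z} → x ≈ y → y ≈ z → x ≈ z
≈-trans {x} {y} {z} x≈y y≈z = null-cong
  (λ n → solve 3 (λ p q r → (p :- q) :+ (q :- r) := p :- r) refl (seq x n) (seq y n) (seq z n))
  (null-+ x≈y y≈z)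
  where open +-*-Solver

p≤∣p∣ : ∀ p → p ℚ.≤ ℚ.∣ p ∣
p≤∣p∣ p with ℚ.≤-total 0ℚ p
... | inj₁ 0≤p = ℚ.≤-reflexive (sym (ℚ.0≤p⇒∣p∣≡p 0≤p))
... | inj₂ p≤0 = ℚ.≤-trans p≤0 (ℚ.0≤∣p∣ p)

≤-fromℚ : ∀ x {p q} → p ℚ.≤ q → x ≈ fromℚ q → fromℚ p ≤ x
≤-fromℚ x {p} {q} p≤q x≈q ε 0<ε with N , h ← x≈q ε 0<ε = N , λ n N≤n → begin
  p                                        ≤⟨ p≤q ⟩
  q                                        ≡⟨ solve 2 (λ q s → q := s :+ (:- (s :- q))) refl q (seq x n) ⟩
  seq x n ℚ.+ (ℚ.- (seq x n ℚ.- q))        ≤⟨ ℚ.+-monoʳ-≤ (seq x n) (p≤∣p∣ (ℚ.- (seq x n ℚ.- q))) ⟩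
  seq x n ℚ.+ ℚ.∣ ℚ.- (seq x n ℚ.- q) ∣    ≡⟨ cong (seq x n ℚ.+_) (ℚ.∣-p∣≡∣p∣ (seq x n ℚ.- q)) ⟩
  seq x n ℚ.+ ℚ.∣ seq x n ℚ.- q ∣          ≤⟨ ℚ.+-monoʳ-≤ (seq x n) (h n N≤n) ⟩
  seq x n ℚ.+ ε                            ∎
  where
  open ℚ.≤-Reasoning
  open +-*-Solver

sum-distrib-minus : ∀ {n} (f g : Fin n → ℚ) → Sumℚ.sum (λ j → f j ℚ.- g j) ≡ Sumℚ.sum f ℚ.- Sumℚ.sum g
sum-distrib-minus {zero}  f g = refl
sum-distrib-minus {suc n} f g = trans (cong (f zero ℚ.- g zero ℚ.+_) (sum-distrib-minus (f ∘ suc) (g ∘ suc)))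
  (solve 4 (λ a b c d → a :- b :+ (c :- d) := a :+ c :- (b :+ d)) refl
    (f zero) (g zero) (Sumℚ.sum (f ∘ suc)) (Sumℚ.sum (g ∘ suc)))
  where open +-*-Solver

-- Since `ab - pq = (a - p)(b - q) + p(b - q) + q(a - p)`, the error splits into products of two
-- null sequences and constant multiples of null sequences.
⟨⟩-fromℚ : ∀ {n} (x y : ℝ^ n) (p q : Fin n → ℚ) → x ≋ fromℚ ∘ p → y ≋ fromℚ ∘ q →
  ⟨ x , y ⟩ ≈ fromℚ (Sumℚ.sum (λ j → p j ℚ.* q j))
⟨⟩-fromℚ x y p q x≋p y≋q = null-cong difference
  (null-sum λ j → null-+ (null-* (x≋p j) (y≋q j)) (null-+ (null-*ˡ (p j) (y≋q j)) (null-*ˡ (q j) (x≋p j))))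
  where
  open +-*-Solver
  open ≡-Reasoning
  difference : ∀ n →
    Sumℚ.sum (λ j → (seq (x j) n ℚ.- p j) ℚ.* (seq (y j) n ℚ.- q j)
      ℚ.+ (p j ℚ.* (seq (y j) n ℚ.- q j) ℚ.+ q j ℚ.* (seq (x j) n ℚ.- p j)))
    ≡ seq ⟨ x , y ⟩ n ℚ.- Sumℚ.sum (λ j → p j ℚ.* q j)
  difference n = begin
    Sumℚ.sum (λ j → (seq (x j) n ℚ.- p j) ℚ.* (seq (y j) n ℚ.- q j)
      ℚ.+ (p j ℚ.* (seq (y j) n ℚ.- q j) ℚ.+ q j ℚ.* (seq (x j) n ℚ.- p j)))
      ≡⟨ Sumℚ.sum-cong-≗ (λ j → solve 4 (λ a b p q →
           (a :- p) :* (b :- q) :+ (p :* (b :- q) :+ q :* (a :- p)) := a :* b :- p :* q) refl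
           (seq (x j) n) (seq (y j) n) (p j) (q j)) ⟩
    Sumℚ.sum (λ j → seq (x j) n ℚ.* seq (y j) n ℚ.- p j ℚ.* q j)
      ≡⟨ sum-distrib-minus (λ j → seq (x j) n ℚ.* seq (y j) n) (λ j → p j ℚ.* q j) ⟩
    Sumℚ.sum (λ j → seq (x j) n ℚ.* seq (y j) n) ℚ.- Sumℚ.sum (λ j → p j ℚ.* q j)
      ≡⟨ cong (ℚ._- Sumℚ.sum (λ j → p j ℚ.* q j)) (seq-sum (λ j → x j * y j) n) ⟨
    seq ⟨ x , y ⟩ n ℚ.- Sumℚ.sum (λ j → p j ℚ.* q j) ∎

-- Lattices with a rational basis

-- B holds the basis, D the dual basis.
module RationalLattice {n : ℕ} (B D : Fin n → Fin n → ℚ) (Γ Δ : Fin n → Fin n → ℤ)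
  (B∙D : ∀ i l → Sumℚ.sum (λ j → B i j ℚ.* D l j) ≡ Sumℚ.δ i l)
  (DᵀB : ∀ j l → Sumℚ.sum (λ i → D i j ℚ.* B i l) ≡ Sumℚ.δ j l)
  (B∙B : ∀ i l → Sumℚ.sum (λ j → B i j ℚ.* B l j) ≡ ι (Γ i l))
  (D∙D : ∀ i l → Sumℚ.sum (λ j → D i j ℚ.* D l j) ≡ ι (Δ i l))
  where

  open ≡-Reasoning
  open Sumℚ using (sum-cong-≗; sum-*-assoc; sum-δ; δ)

  rows : Fin n → ℝ^ n
  rows i j = fromℚ (B i j)

  -- Pairing a combination with row `l` of `D` recovers the coefficient `c l`. This is an exact
  -- rational identity at each sequence index; limits enter only through the vanishing of the
  -- combination.
  rows-independent : LinearlyIndependent rows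
  rows-independent c c≋0 l = null-cong coefficient (null-sum λ j → null-*ˡ (D l j) (c≋0 j))
    where
    coefficient : ∀ m → Sumℚ.sum (λ j → D l j ℚ.* (seq (combination c rows j) m ℚ.- 0ℚ)) ≡ seq (c l) m ℚ.- 0ℚ
    coefficient m = begin
      Sumℚ.sum (λ j → D l j ℚ.* (seq (combination c rows j) m ℚ.- 0ℚ))
        ≡⟨ sum-cong-≗ (λ j → trans (ℚ.*-comm (D l j) _)
             (cong (ℚ._* D l j) (trans (ℚ.+-identityʳ _) (seq-sum (λ i → c i * rows i j) m)))) ⟩
      Sumℚ.sum (λ j → Sumℚ.sum (λ i → seq (c i) m ℚ.* B i j) ℚ.* D l j)
        ≡⟨ sum-*-assoc (λ i → seq (c i) m) B (D l) ⟩
      Sumℚ.sum (λ i → seq (c i) m ℚ.* Sumℚ.sum (λ j → B i j ℚ.* D l j))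
        ≡⟨ sum-cong-≗ (λ i → cong (seq (c i) m ℚ.*_) (B∙D i l)) ⟩
      Sumℚ.sum (λ i → seq (c i) m ℚ.* δ i l)
        ≡⟨ sum-δ (λ i → seq (c i) m) l ⟩
      seq (c l) m
        ≡⟨ ℚ.+-identityʳ (seq (c l) m) ⟨
      seq (c l) m ℚ.- 0ℚ ∎

  lattice : Lattice n
  lattice = record { basis = rows ; independent = rows-independent }

  point : (Fin n → ℤ) → Fin n → ℚ
  point c j = Sumℚ.sum (λ i → ι (c i) ℚ.* B i j)

  seq-combination : ∀ c j m → seq (combination (λ i → fromℤ (c i)) rows j) m ≡ point c j
  seq-combination c j m = seq-sum (λ i → fromℤ (c i) * rows i j) m

  Points⇒≋point : ∀ x ((c , _) : Points lattice x) → x ≋ fromℚ ∘ point c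
  Points⇒≋point x (c , x≋c) j = null-cong (λ m → cong (λ q → seq (x j) m ℚ.- q) (seq-combination c j m)) (x≋c j)

  ≋point⇒Points : ∀ x c → x ≋ fromℚ ∘ point c → Points lattice x
  ≋point⇒Points x c x≋c = c , λ j →
    null-cong (λ m → cong (λ q → seq (x j) m ℚ.- q) (sym (seq-combination c j m))) (x≋c j)

  -- The Gram matrix as an integral bilinear form on coordinate vectors.
  inner : (c d : Fin n → ℤ) → ℤ
  inner c d = Sumℤ.sum (λ i → c i ℤ.* Sumℤ.sum (λ l → d l ℤ.* Γ i l))

  inner-point : ∀ c d → Sumℚ.sum (λ j → point c j ℚ.* point d j) ≡ ι (inner c d)
  inner-point c d = begin
    Sumℚ.sum (λ j → point c j ℚ.* point d j)
      ≡⟨ sum-*-assoc (ι ∘ c) B (point d) ⟩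
    Sumℚ.sum (λ i → ι (c i) ℚ.* Sumℚ.sum (λ j → B i j ℚ.* point d j))
      ≡⟨ sum-cong-≗ (λ i → cong (ι (c i) ℚ.*_) (row i)) ⟩
    Sumℚ.sum (λ i → ι (c i) ℚ.* ι (Sumℤ.sum (λ l → d l ℤ.* Γ i l)))
      ≡⟨ sum-cong-≗ (λ i → ι-* (c i) _) ⟨
    Sumℚ.sum (λ i → ι (c i ℤ.* Sumℤ.sum (λ l → d l ℤ.* Γ i l)))
      ≡⟨ ι-sum (λ i → c i ℤ.* Sumℤ.sum (λ l → d l ℤ.* Γ i l)) ⟨
    ι (inner c d) ∎
    where
    row : ∀ i → Sumℚ.sum (λ j → B i j ℚ.* point d j) ≡ ι (Sumℤ.sum (λ l → d l ℤ.* Γ i l))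
    row i = begin
      Sumℚ.sum (λ j → B i j ℚ.* point d j)
        ≡⟨ sum-cong-≗ (λ j → ℚ.*-comm (B i j) (point d j)) ⟩
      Sumℚ.sum (λ j → point d j ℚ.* B i j)
        ≡⟨ sum-*-assoc (ι ∘ d) B (B i) ⟩
      Sumℚ.sum (λ l → ι (d l) ℚ.* Sumℚ.sum (λ j → B l j ℚ.* B i j))
        ≡⟨ sum-cong-≗ (λ l → cong (ι (d l) ℚ.*_)
             (trans (sum-cong-≗ (λ j → ℚ.*-comm (B l j) (B i j))) (B∙B i l))) ⟩
      Sumℚ.sum (λ l → ι (d l) ℚ.* ι (Γ i l))
        ≡⟨ sum-cong-≗ (λ l → ι-* (d l) (Γ i l)) ⟨
      Sumℚ.sum (λ l → ι (d l ℤ.* Γ i l))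
        ≡⟨ ι-sum (λ l → d l ℤ.* Γ i l) ⟨
      ι (Sumℤ.sum (λ l → d l ℤ.* Γ i l)) ∎

  ⟨⟩-points : ∀ x y ((c , _) : Points lattice x) ((d , _) : Points lattice y) →
    ⟨ x , y ⟩ ≈ fromℤ (inner c d)
  ⟨⟩-points x y px@(c , _) py@(d , _) = subst (λ q → ⟨ x , y ⟩ ≈ fromℚ q) (inner-point c d)
    (⟨⟩-fromℚ x y (point c) (point d) (Points⇒≋point x px) (Points⇒≋point y py))

  point-δ : ∀ l j → point (λ i → Sumℤ.δ i l) j ≡ B l j
  point-δ l j = begin
    Sumℚ.sum (λ i → ι (Sumℤ.δ i l) ℚ.* B i j)
      ≡⟨ sum-cong-≗ (λ i → trans (cong (ℚ._* B i j) (ι-δ i l)) (ℚ.*-comm _ (B i j))) ⟩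
    Sumℚ.sum (λ i → B i j ℚ.* δ i l)
      ≡⟨ sum-δ (λ i → B i j) l ⟩
    B l j ∎

  rows∈Points : ∀ l → Points lattice (rows l)
  rows∈Points l = ≋point⇒Points (rows l) (λ i → Sumℤ.δ i l)
    λ j → null-cong (λ _ → sym (trans (cong (λ q → B l j ℚ.- q) (point-δ l j)) (ℚ.+-inverseʳ (B l j)))) null-0

  norm-rows : ∀ l → norm (rows l) ≈ fromℤ (Γ l l)
  norm-rows l = null-cong (λ m → begin
      0ℚ
        ≡⟨ ℚ.+-inverseʳ (ι (Γ l l)) ⟨
      ι (Γ l l) ℚ.- ι (Γ l l)
        ≡⟨ cong (ℚ._- ι (Γ l l)) (trans (seq-sum (λ j → rows l j * rows l j) m) (B∙B l l)) ⟨
      seq (norm (rows l)) m ℚ.- ι (Γ l l) ∎) null-0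

  -- The coordinates with respect to the dual basis of a vector of the dual lattice are
  -- integral, and the dual basis consists of lattice vectors because its Gram matrix is integral.
  unimodular : Unimodular lattice
  unimodular = (λ {x} px@(c , _) y py@(d , _) → inner c d , ⟨⟩-points x y px py) , Dual⊆Points
    where
    Dual⊆Points : ∀ {x} → Dual lattice x → Points lattice x
    Dual⊆Points {x} x∈L* = ≋point⇒Points x c λ j →
      null-cong (coordinate j) (null-sum λ i → null-*ˡ (D i j) (proj₂ (x∈L* (rows i) (rows∈Points i))))
      where
      k : Fin n → ℤ
      k i = proj₁ (x∈L* (rows i) (rows∈Points i))
      -- `x` is the combination of the rows of `D` with coefficients `k`, and row `i` of `D` has
      -- coordinates `Δ i` in the basis `B`.
      c : Fin n → ℤ
      c l = Sumℤ.sum (λ i → k i ℤ.* Δ i l)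

      -- In matrix form, `Δ B = (D Dᵀ) B = D (Dᵀ B) = D`.
      Δ-row : ∀ i j → Sumℚ.sum (λ l → ι (Δ i l) ℚ.* B l j) ≡ D i j
      Δ-row i j = begin
        Sumℚ.sum (λ l → ι (Δ i l) ℚ.* B l j)
          ≡⟨ sum-cong-≗ (λ l → cong (ℚ._* B l j) (D∙D i l)) ⟨
        Sumℚ.sum (λ l → Sumℚ.sum (λ m → D i m ℚ.* D l m) ℚ.* B l j)
          ≡⟨ sum-*-assoc (D i) (λ m l → D l m) (λ l → B l j) ⟩
        Sumℚ.sum (λ m → D i m ℚ.* Sumℚ.sum (λ l → D l m ℚ.* B l j))
          ≡⟨ sum-cong-≗ (λ m → cong (D i m ℚ.*_) (DᵀB m j)) ⟩
        Sumℚ.sum (λ m → D i m ℚ.* δ m j)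
          ≡⟨ sum-δ (D i) j ⟩
        D i j ∎

      point-c : ∀ j → point c j ≡ Sumℚ.sum (λ i → ι (k i) ℚ.* D i j)
      point-c j = begin
        Sumℚ.sum (λ l → ι (c l) ℚ.* B l j)
          ≡⟨ sum-cong-≗ (λ l → cong (ℚ._* B l j)
               (trans (ι-sum (λ i → k i ℤ.* Δ i l)) (sum-cong-≗ (λ i → ι-* (k i) (Δ i l))))) ⟩
        Sumℚ.sum (λ l → Sumℚ.sum (λ i → ι (k i) ℚ.* ι (Δ i l)) ℚ.* B l j)
          ≡⟨ sum-*-assoc (ι ∘ k) (λ i l → ι (Δ i l)) (λ l → B l j) ⟩
        Sumℚ.sum (λ i → ι (k i) ℚ.* Sumℚ.sum (λ l → ι (Δ i l) ℚ.* B l j))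
          ≡⟨ sum-cong-≗ (λ i → cong (ι (k i) ℚ.*_) (Δ-row i j)) ⟩
        Sumℚ.sum (λ i → ι (k i) ℚ.* D i j) ∎

      -- The inner products with a basis are the coordinates in the dual basis: `x Bᵀ D = x`, the
      -- transpose of `Dᵀ B = I`, at every index `m`.
      expand : ∀ j m → Sumℚ.sum (λ i → seq ⟨ x , rows i ⟩ m ℚ.* D i j) ≡ seq (x j) m
      expand j m = begin
        Sumℚ.sum (λ i → seq ⟨ x , rows i ⟩ m ℚ.* D i j)
          ≡⟨ sum-cong-≗ (λ i → cong (ℚ._* D i j) (seq-sum (λ l → x l * rows i l) m)) ⟩
        Sumℚ.sum (λ i → Sumℚ.sum (λ l → seq (x l) m ℚ.* B i l) ℚ.* D i j)
          ≡⟨ sum-*-assoc (λ l → seq (x l) m) (λ l i → B i l) (λ i → D i j) ⟩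
        Sumℚ.sum (λ l → seq (x l) m ℚ.* Sumℚ.sum (λ i → B i l ℚ.* D i j))
          ≡⟨ sum-cong-≗ (λ l → cong (seq (x l) m ℚ.*_)
               (trans (sum-cong-≗ (λ i → ℚ.*-comm (B i l) (D i j))) (DᵀB j l))) ⟩
        Sumℚ.sum (λ l → seq (x l) m ℚ.* δ j l)
          ≡⟨ sum-cong-≗ (λ l → ℚ.*-comm (seq (x l) m) (δ j l)) ⟩
        Sumℚ.sum (λ l → δ j l ℚ.* seq (x l) m)
          ≡⟨ Sumℚ.δ-sum (λ l → seq (x l) m) j ⟩
        seq (x j) m ∎

      coordinate : ∀ j m → Sumℚ.sum (λ i → D i j ℚ.* (seq ⟨ x , rows i ⟩ m ℚ.- ι (k i)))
        ≡ seq (x j) m ℚ.- point c j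
      coordinate j m = begin
        Sumℚ.sum (λ i → D i j ℚ.* (seq ⟨ x , rows i ⟩ m ℚ.- ι (k i)))
          ≡⟨ sum-cong-≗ (λ i → solve 3 (λ d s k → d :* (s :- k) := s :* d :- k :* d) refl
               (D i j) (seq ⟨ x , rows i ⟩ m) (ι (k i))) ⟩
        Sumℚ.sum (λ i → seq ⟨ x , rows i ⟩ m ℚ.* D i j ℚ.- ι (k i) ℚ.* D i j)
          ≡⟨ sum-distrib-minus (λ i → seq ⟨ x , rows i ⟩ m ℚ.* D i j) (λ i → ι (k i) ℚ.* D i j) ⟩
        Sumℚ.sum (λ i → seq ⟨ x , rows i ⟩ m ℚ.* D i j) ℚ.- Sumℚ.sum (λ i → ι (k i) ℚ.* D i j)
          ≡⟨ cong₂ ℚ._-_ (expand j m) (sym (point-c j)) ⟩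
        seq (x j) m ℚ.- point c j ∎
        where open +-*-Solver

  odd : ∀ l → (∀ k → Γ l l ≢ + 2 ℤ.* k) → ¬ Even lattice
  odd l Γₗₗ≢2k even with k , norm≈2k ← even (rows l) (rows∈Points l) =
    Γₗₗ≢2k k (ι-injective (fromℚ-injective {ι (Γ l l)} {ι (+ 2 ℤ.* k)}
      (≈-trans {fromℤ (Γ l l)} {norm (rows l)} {fromℤ (+ 2 ℤ.* k)}
        (≈-sym {norm (rows l)} {fromℤ (Γ l l)} (norm-rows l)) norm≈2k)))

  -- For a real vector, being nonzero is a bare negation and yields no witness. The hypothesis
  -- therefore decides on rational coordinates: each point either vanishes exactly or satisfies the
  -- bound.
  minimumNorm : ∀ l → Γ l l ≢ + 0 →
    (∀ c → (∀ j → point c j ≡ 0ℚ) ⊎ ι (Γ l l) ℚ.≤ Sumℚ.sum (λ j → point c j ℚ.* point c j)) →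
    HasMinimumNorm lattice (fromℤ (Γ l l))
  minimumNorm l Γₗₗ≢0 bound = (rows l , rows∈Points l , rows≢𝟎 , norm-rows l) , lower
    where
    rows≢𝟎 : ¬ rows l ≋ 𝟎
    rows≢𝟎 rₗ≋𝟎 = Γₗₗ≢0 (ι-injective (trans (sym (B∙B l l)) (begin
      Sumℚ.sum (λ j → B l j ℚ.* B l j)
        ≡⟨ sum-cong-≗ (λ j → cong (λ q → q ℚ.* B l j) (fromℚ-injective {B l j} {0ℚ} (rₗ≋𝟎 j))) ⟩
      Sumℚ.sum (λ j → 0ℚ ℚ.* B l j)
        ≡⟨ Sumℚ.zero-sum (B l) ⟩
      0ℚ ∎)))
    lower : ∀ x → x ∈ Points lattice → ¬ x ≋ 𝟎 → fromℤ (Γ l l) ≤ norm x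
    lower x px@(c , _) x≢𝟎 with bound c
    ... | inj₁ c≡0 = contradiction
      (λ j → null-cong (λ m → cong (λ q → seq (x j) m ℚ.- q) (c≡0 j)) (Points⇒≋point x px j)) x≢𝟎
    ... | inj₂ Γₗₗ≤q = ≤-fromℚ (norm x) Γₗₗ≤q
      (⟨⟩-fromℚ x x (point c) (point c) (Points⇒≋point x px) (Points⇒≋point x px))

-- Parities and binary codes

module Sumℙ = FiniteSums (CommutativeSemiring.semiring ℙ.+-*-commutativeSemiring)

parityℤ : ℤ → Parity
parityℤ k = parity ∣ k ∣

-- Lowering both arguments by one flips both parities, and the two flips cancel in the sum.
parity-⊖ : ∀ m n → parityℤ (m ℤ.⊖ n) ≡ parity m ℙ.+ parity n
parity-⊖ zero    zero    = refl
parity-⊖ zero    (suc n) = refl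
parity-⊖ (suc m) zero    = sym (ℙ.+-identityʳ (parity (suc m)))
parity-⊖ (suc m) (suc n) = begin
  parityℤ (suc m ℤ.⊖ suc n)               ≡⟨ cong parityℤ (ℤ.[1+m]⊖[1+n]≡m⊖n m n) ⟩
  parityℤ (m ℤ.⊖ n)                       ≡⟨ parity-⊖ m n ⟩
  parity m ℙ.+ parity n                   ≡⟨ cong₂ ℙ._+_ (ℙ.suc-homo-⁻¹ m) (ℙ.suc-homo-⁻¹ n) ⟨
  parity (suc m) ℙ.⁻¹ ℙ.+ parity (suc n) ℙ.⁻¹ ≡⟨ cancel (parity (suc m)) (parity (suc n)) ⟩
  parity (suc m) ℙ.+ parity (suc n)       ∎
  where
  open ≡-Reasoning
  cancel : ∀ p q → p ℙ.⁻¹ ℙ.+ q ℙ.⁻¹ ≡ p ℙ.+ q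
  cancel 0ℙ 0ℙ = refl
  cancel 0ℙ 1ℙ = refl
  cancel 1ℙ 0ℙ = refl
  cancel 1ℙ 1ℙ = refl

parity-+ : ∀ k l → parityℤ (k ℤ.+ l) ≡ parityℤ k ℙ.+ parityℤ l
parity-+ (+ m)    (+ n)    = ℙ.+-homo-+ m n
parity-+ (+ m)    -[1+ n ] = parity-⊖ m (suc n)
parity-+ -[1+ m ] (+ n)    = trans (parity-⊖ n (suc m)) (ℙ.+-comm (parity n) (parity (suc m)))
parity-+ -[1+ m ] -[1+ n ] = trans (cong (parity ∘ suc) (sym (ℕ.+-suc m n))) (ℙ.+-homo-+ (suc m) (suc n))

parity-* : ∀ k l → parityℤ (k ℤ.* l) ≡ parityℤ k ℙ.* parityℤ l
parity-* k l = trans (cong parity (ℤ.abs-* k l)) (ℙ.*-homo-* ∣ k ∣ ∣ l ∣)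

parity-sum : ∀ {n} (f : Fin n → ℤ) → parityℤ (Sumℤ.sum f) ≡ Sumℙ.sum (parityℤ ∘ f)
parity-sum {zero}  f = refl
parity-sum {suc n} f = trans (parity-+ (f zero) _) (cong (parityℤ (f zero) ℙ.+_) (parity-sum (f ∘ suc)))

halveℕ : ∀ n → parity n ≡ 0ℙ → ∃[ m ] n ≡ 2 ℕ.* m
halveℕ zero          _ = 0 , refl
halveℕ (suc (suc n)) p with m , n≡2m ← halveℕ n p =
  suc m , trans (cong (λ k → suc (suc k)) n≡2m) (sym (ℕ.*-suc 2 m))

halve : ∀ k → parityℤ k ≡ 0ℙ → ∃[ l ] k ≡ + 2 ℤ.* l
halve (+ n)    p with m , n≡2m ← halveℕ n p = + m , trans (cong +_ n≡2m) (ℤ.pos-* 2 m)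
halve -[1+ n ] p with m , n≡2m ← halveℕ (suc n) p =
  ℤ.- + m , trans (cong (λ k → ℤ.- + k) n≡2m)
    (trans (cong ℤ.-_ (ℤ.pos-* 2 m)) (ℤ.neg-distribʳ-* (+ 2) (+ m)))

∣-sum : ∀ {n k} {f : Fin n → ℤ} → (∀ i → k ∣ f i) → k ∣ Sumℤ.sum f
∣-sum {zero}  h = divides (+ 0) refl
∣-sum {suc n} h = ∣m∣n⇒∣m+n (h zero) (∣-sum (h ∘ suc))

-- Norms and parity weights of integer vectors

normℤ : ∀ {n} → (Fin n → ℤ) → ℤ
normℤ v = Sumℤ.sum (λ j → v j ℤ.* v j)

normℤ-double : ∀ {n} {v y : Fin n → ℤ} → (∀ j → v j ≡ + 2 ℤ.* y j) → normℤ v ≡ + 4 ℤ.* normℤ y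
normℤ-double {v = v} {y} v≡2y = trans
  (Sumℤ.sum-cong-≗ λ j → trans (cong (λ k → k ℤ.* k) (v≡2y j))
    (solve 1 (λ y → (con (+ 2) :* y) :* (con (+ 2) :* y) := con (+ 4) :* (y :* y)) refl (y j)))
  (sym (Sumℤ.*-distribˡ-sum (+ 4) (λ j → y j ℤ.* y j)))
  where open ℤ-Solver.+-*-Solver

square : ∀ k → k ℤ.* k ≡ + (∣ k ∣ ℕ.* ∣ k ∣)
square (+ n)    = sym (ℤ.pos-* n n)
square -[1+ n ] = refl

bit : Parity → ℕ
bit 0ℙ = 0
bit 1ℙ = 1

weight : ∀ {n} → Vec Parity n → ℕ
weight []      = 0
weight (p ∷ w) = bit p ℕ.+ weight w

bit-parity≤square : ∀ k → + bit (parityℤ k) ℤ.≤ k ℤ.* k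
bit-parity≤square k = subst (+ bit (parityℤ k) ℤ.≤_) (sym (square k)) (ℤ.+≤+ (bound ∣ k ∣))
  where
  bit≤1 : ∀ p → bit p ℕ.≤ 1
  bit≤1 0ℙ = z≤n
  bit≤1 1ℙ = s≤s z≤n
  bound : ∀ n → bit (parity n) ℕ.≤ n ℕ.* n
  bound zero    = z≤n
  bound (suc n) = ℕ.≤-trans (bit≤1 (parity (suc n))) (s≤s z≤n)

-- The weight counts the odd entries, and each odd entry contributes at least 1 to the norm.
weight≤normℤ : ∀ {n} (v : Fin n → ℤ) → + weight (tabulate (parityℤ ∘ v)) ℤ.≤ normℤ v
weight≤normℤ {zero}  v = ℤ.≤-refl
weight≤normℤ {suc n} v = ℤ.+-mono-≤ (bit-parity≤square (v zero)) (weight≤normℤ (v ∘ suc))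

normℤ-nonZero : ∀ {n} (v : Fin n → ℤ) → (∀ j → v j ≡ + 0) ⊎ + 1 ℤ.≤ normℤ v
normℤ-nonZero {zero}  v = inj₁ λ ()
normℤ-nonZero {suc n} v with v zero ℤ.≟ + 0 | normℤ-nonZero (v ∘ suc)
... | yes v₀≡0 | inj₁ v≡0  = inj₁ λ { zero → v₀≡0 ; (suc j) → v≡0 j }
... | _        | inj₂ 1≤v² = inj₂ (ℤ.+-mono-≤ (0≤square (v zero)) 1≤v²)
  where
  0≤square : ∀ k → + 0 ℤ.≤ k ℤ.* k
  0≤square k = subst (+ 0 ℤ.≤_) (sym (square k)) (ℤ.+≤+ z≤n)
... | no v₀≢0  | inj₁ v≡0  = inj₂ (ℤ.+-mono-≤ (1≤square (v zero) v₀≢0) (ℤ.≤-reflexive (sym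
  (trans (Sumℤ.sum-cong-≗ λ j → cong (λ k → k ℤ.* v (suc j)) (v≡0 j)) (Sumℤ.zero-sum (v ∘ suc))))))
  where
  1≤square : ∀ k → k ≢ + 0 → + 1 ℤ.≤ k ℤ.* k
  1≤square (+ zero)  k≢0 = contradiction refl k≢0
  1≤square (+ suc n) k≢0 = ℤ.+≤+ (s≤s z≤n)
  1≤square -[1+ n ]  k≢0 = ℤ.+≤+ (s≤s z≤n)

-- Enumeration and search in binary codes

𝟘 : ∀ {n} → Vec Parity n
𝟘 = replicate _ 0ℙ

add : ∀ {n} → Parity → Vec Parity n → Vec Parity n → Vec Parity n
add 0ℙ x a = a
add 1ℙ x a = zipWith ℙ._+_ a x

-- Written with an accumulator, so that its recursion matches those of `translates` and
-- `lightCombinations≢𝟘?`, which also add one row at a time to a partial sum.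
combine : ∀ {m n} → Vec Parity n → Vec Parity m → Vec (Vec Parity n) m → Vec Parity n
combine a []      []       = a
combine a (c ∷ cs) (x ∷ xs) = combine (add c x a) cs xs

lookup-add : ∀ {n} c (x a : Vec Parity n) j → lookup (add c x a) j ≡ lookup a j ℙ.+ (c ℙ.* lookup x j)
lookup-add 0ℙ x a j = sym (ℙ.+-identityʳ (lookup a j))
lookup-add 1ℙ x a j = lookup-zipWith ℙ._+_ j a x

lookup-combine : ∀ {m n} (a : Vec Parity n) (c : Vec Parity m) (xs : Vec (Vec Parity n) m) j →
  lookup (combine a c xs) j ≡ lookup a j ℙ.+ Sumℙ.sum (λ i → lookup c i ℙ.* lookup (lookup xs i) j)
lookup-combine a []      []       j = sym (ℙ.+-identityʳ (lookup a j))
lookup-combine a (c ∷ cs) (x ∷ xs) j = begin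
  lookup (combine (add c x a) cs xs) j
    ≡⟨ lookup-combine (add c x a) cs xs j ⟩
  lookup (add c x a) j ℙ.+ rest
    ≡⟨ cong (ℙ._+ rest) (lookup-add c x a j) ⟩
  lookup a j ℙ.+ (c ℙ.* lookup x j) ℙ.+ rest
    ≡⟨ ℙ.+-assoc (lookup a j) (c ℙ.* lookup x j) rest ⟩
  lookup a j ℙ.+ ((c ℙ.* lookup x j) ℙ.+ rest) ∎
  where
  open ≡-Reasoning
  rest : Parity
  rest = Sumℙ.sum (λ i → lookup cs i ℙ.* lookup (lookup xs i) j)

_≟ᵥ_ : ∀ {n} (a b : Vec Parity n) → Dec (a ≡ b)
_≟ᵥ_ = ≡-dec ℙ._≟_

-- Dropping zero rows keeps the list as short as the code generated by the rows.
adjoin : ∀ {n} → Vec Parity n → List (Vec Parity n) → List (Vec Parity n)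
adjoin x ws with x ≟ᵥ 𝟘
... | yes _ = ws
... | no  _ = ws List.++ List.map (add 1ℙ x) ws

translates : ∀ {m n} → List (Vec Parity n) → Vec (Vec Parity n) m → List (Vec Parity n)
translates ws []       = ws
translates ws (x ∷ xs) = translates (adjoin x ws) xs

span : ∀ {m n} → Vec (Vec Parity n) m → List (Vec Parity n)
span = translates List.[ 𝟘 ]

add∈adjoin : ∀ {n} c (x : Vec Parity n) {a ws} → a ∈ˡ ws → add c x a ∈ˡ adjoin x ws
add∈adjoin c x {a} a∈ws with x ≟ᵥ 𝟘
add∈adjoin 0ℙ x     a∈ws | yes _    = a∈ws
add∈adjoin 1ℙ x {a} a∈ws | yes refl = subst (_∈ˡ _) (sym (zipWith-identityʳ ℙ.+-identityʳ a)) a∈ws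
add∈adjoin 0ℙ x     a∈ws | no _     = ∈-++⁺ˡ a∈ws
add∈adjoin 1ℙ x     a∈ws | no _     = ∈-++⁺ʳ _ (∈-map⁺ (add 1ℙ x) a∈ws)

combine∈translates : ∀ {m n} c (xs : Vec (Vec Parity n) m) {a ws} → a ∈ˡ ws → combine a c xs ∈ˡ translates ws xs
combine∈translates []       []       a∈ws = a∈ws
combine∈translates (c ∷ cs) (x ∷ xs) a∈ws = combine∈translates cs xs (add∈adjoin c x a∈ws)

-- Turns a check of the finitely many listed words into a statement about all coefficient vectors.
combine∈span : ∀ {m n} c (xs : Vec (Vec Parity n) m) → combine 𝟘 c xs ∈ˡ span xs
combine∈span c xs = combine∈translates c xs (here refl)

-- Each row that is taken lowers the budget `t`, so the search visits only sums of at most `t` rows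
-- instead of all combinations.
lightCombinations≢𝟘? : ∀ {m n} t (xs : Vec (Vec Parity n) m) a →
  Dec (∀ c → weight c ℕ.≤ t → combine a c xs ≢ 𝟘)
lightCombinations≢𝟘? t [] a = map′ (λ { a≢𝟘 [] _ → a≢𝟘 }) (λ h → h [] z≤n) (¬? (a ≟ᵥ 𝟘))
lightCombinations≢𝟘? zero (x ∷ xs) a =
  map′ (λ { h (0ℙ ∷ cs) → h cs ; h (1ℙ ∷ cs) () }) (λ h cs → h (0ℙ ∷ cs)) (lightCombinations≢𝟘? zero xs a)
lightCombinations≢𝟘? (suc t) (x ∷ xs) a =
  map′ (λ { (h₀ , h₁) (0ℙ ∷ cs) → h₀ cs ; (h₀ , h₁) (1ℙ ∷ cs) (s≤s c≤t) → h₁ cs c≤t })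
       (λ h → (λ cs → h (0ℙ ∷ cs)) , (λ cs c≤t → h (1ℙ ∷ cs) (s≤s c≤t)))
       (lightCombinations≢𝟘? (suc t) xs a ×-dec lightCombinations≢𝟘? t xs (add 1ℙ x a))

-- A relation is split at its first nonzero coefficient, which leaves at most t further ones to try.
relationsHeavy? : ∀ {m n} t (xs : Vec (Vec Parity n) m) →
  Dec (∀ c → combine 𝟘 c xs ≡ 𝟘 → c ≡ 𝟘 ⊎ suc t ℕ.< weight c)
relationsHeavy? t []       = yes λ { [] _ → inj₁ refl }
relationsHeavy? t (x ∷ xs) = map′ to from
  (relationsHeavy? t xs ×-dec lightCombinations≢𝟘? t xs (add 1ℙ x 𝟘))
  where
  to : (∀ cs → combine 𝟘 cs xs ≡ 𝟘 → cs ≡ 𝟘 ⊎ suc t ℕ.< weight cs) ×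
       (∀ cs → weight cs ℕ.≤ t → combine (add 1ℙ x 𝟘) cs xs ≢ 𝟘) →
       ∀ c → combine 𝟘 c (x ∷ xs) ≡ 𝟘 → c ≡ 𝟘 ⊎ suc t ℕ.< weight c
  to (h , _) (0ℙ ∷ cs) c≡𝟘 = Sum.map₁ (cong (0ℙ ∷_)) (h cs c≡𝟘)
  -- The leading one accounts for the `suc`: what remains is `t < weight cs`, the failure of
  -- `weight cs ≤ t`.
  to (_ , h) (1ℙ ∷ cs) c≡𝟘 = inj₂ (s≤s (ℕ.≰⇒> λ cs≤t → h cs cs≤t c≡𝟘))
  from : (∀ c → combine 𝟘 c (x ∷ xs) ≡ 𝟘 → c ≡ 𝟘 ⊎ suc t ℕ.< weight c) →
       (∀ cs → combine 𝟘 cs xs ≡ 𝟘 → cs ≡ 𝟘 ⊎ suc t ℕ.< weight cs) ×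
       (∀ cs → weight cs ℕ.≤ t → combine (add 1ℙ x 𝟘) cs xs ≢ 𝟘)
  from h = (λ cs cs≡𝟘 → Sum.map₁ (cong Vec.tail) (h (0ℙ ∷ cs) cs≡𝟘)) , light
    where
    light : ∀ cs → weight cs ℕ.≤ t → combine (add 1ℙ x 𝟘) cs xs ≢ 𝟘
    light cs cs≤t c≡𝟘 with h (1ℙ ∷ cs) c≡𝟘
    ... | inj₁ ()
    ... | inj₂ (s≤s t<cs) = ℕ.<⇒≱ t<cs cs≤t

≡𝟘 : ∀ {n} (a : Vec Parity n) → (∀ j → lookup a j ≡ 0ℙ) → a ≡ 𝟘
≡𝟘 []      h = refl
≡𝟘 (p ∷ a) h = cong₂ _∷_ (h zero) (≡𝟘 a (h ∘ suc))

halves : ∀ {n} (v : Fin n → ℤ) → tabulate (parityℤ ∘ v) ≡ 𝟘 → ∃[ y ] ∀ j → v j ≡ + 2 ℤ.* y j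
halves v v≡𝟘 = proj₁ ∘ half , proj₂ ∘ half
  where
  half : ∀ j → ∃[ y ] v j ≡ + 2 ℤ.* y
  half j = halve (v j) (trans (sym (lookup∘tabulate (parityℤ ∘ v) j))
    (trans (cong (λ w → lookup w j) v≡𝟘) (lookup-replicate j 0ℙ)))

-- With `v = 2y` this is the case of vectors divisible by 4: a nonzero `z` has norm at least 1, and
-- doubling multiplies norms by 4.
doubled-norm : ∀ {n} {y : Fin n → ℤ} → (∃[ z ] ∀ j → y j ≡ + 2 ℤ.* z j) → (∀ j → y j ≡ + 0) ⊎ + 4 ℤ.≤ normℤ y
doubled-norm (z , y≡2z) = Sum.map
  (λ z≡0 j → trans (y≡2z j) (cong (+ 2 ℤ.*_) (z≡0 j)))
  (λ 1≤z² → subst (+ 4 ℤ.≤_) (sym (normℤ-double y≡2z)) (ℤ.*-monoˡ-≤-nonNeg (+ 4) 1≤z²))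
  (normℤ-nonZero z)

-- Construction A modulo 4

vector : ∀ {m n} → (Fin m → Fin n → ℤ) → (Fin m → ℤ) → Fin n → ℤ
vector T c j = Sumℤ.sum (λ i → c i ℤ.* T i j)

residues : ∀ {m n} → (Fin m → Fin n → ℤ) → Vec (Vec Parity n) m
residues T = tabulate λ i → tabulate λ j → parityℤ (T i j)

lookup-residues : ∀ {m n} (T : Fin m → Fin n → ℤ) i j → lookup (lookup (residues T) i) j ≡ parityℤ (T i j)
lookup-residues T i j = trans (cong (λ r → lookup r j) (lookup∘tabulate (λ i → tabulate λ j → parityℤ (T i j)) i))
  (lookup∘tabulate (λ j → parityℤ (T i j)) j)

-- The rows of `T` generate `C`, and `T∙T` makes `C` self-orthogonal modulo 4. A relation between
-- the columns of `T` modulo 2 is a word orthogonal to every row, so `torsionWeight` speaks of the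
-- dual of the residue code.
module ConstructionA {n : ℕ} (T : Fin n → Fin n → ℤ)
  (T∙T : ∀ i l → + 4 ∣ Sumℤ.sum (λ j → T i j ℤ.* T l j))
  (residueWeight : All (λ w → w ≡ 𝟘 ⊎ 16 ℕ.≤ weight w) (span (residues T)))
  (torsionWeight : ∀ w → combine 𝟘 w (residues (λ j i → T i j)) ≡ 𝟘 → w ≡ 𝟘 ⊎ 4 ℕ.≤ weight w)
  where

  open ≡-Reasoning

  Tᵀ : Fin n → Fin n → ℤ
  Tᵀ j i = T i j

  residue : (c : Fin n → ℤ) → combine 𝟘 (tabulate (parityℤ ∘ c)) (residues T) ≡ tabulate (parityℤ ∘ vector T c)
  residue c = trans (sym (tabulate∘lookup _)) (tabulate-cong λ j → begin
    lookup (combine 𝟘 (tabulate (parityℤ ∘ c)) (residues T)) j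
      ≡⟨ lookup-combine 𝟘 (tabulate (parityℤ ∘ c)) (residues T) j ⟩
    lookup 𝟘 j ℙ.+ Sumℙ.sum (λ i → lookup (tabulate (parityℤ ∘ c)) i ℙ.* lookup (lookup (residues T) i) j)
      ≡⟨ cong₂ ℙ._+_ (lookup-replicate j 0ℙ) (Sumℙ.sum-cong-≗ λ i →
           trans (cong₂ ℙ._*_ (lookup∘tabulate (parityℤ ∘ c) i) (lookup-residues T i j))
             (sym (parity-* (c i) (T i j)))) ⟩
    Sumℙ.sum (λ i → parityℤ (c i ℤ.* T i j))
      ≡⟨ parity-sum (λ i → c i ℤ.* T i j) ⟨
    parityℤ (vector T c j) ∎)

  4∣vector∙T : ∀ c i → + 4 ∣ Sumℤ.sum (λ j → vector T c j ℤ.* T i j)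
  4∣vector∙T c i = subst (+ 4 ∣_) (sym (Sumℤ.sum-*-assoc c T (T i)))
    (∣-sum (λ l → ∣n⇒∣m*n (c l) (T∙T l i)))

  -- If `2y` lies in `C`, its inner product with each row of `T` is divisible by 4, so that of `y`
  -- is even: `y` modulo 2 is orthogonal to the residue code.
  syndrome : ∀ c (y : Fin n → ℤ) → (∀ j → vector T c j ≡ + 2 ℤ.* y j) →
    combine 𝟘 (tabulate (parityℤ ∘ y)) (residues Tᵀ) ≡ 𝟘
  syndrome c y v≡2y = ≡𝟘 _ λ i → begin
    lookup (combine 𝟘 (tabulate (parityℤ ∘ y)) (residues Tᵀ)) i
      ≡⟨ lookup-combine 𝟘 (tabulate (parityℤ ∘ y)) (residues Tᵀ) i ⟩
    lookup 𝟘 i ℙ.+ Sumℙ.sum (λ j → lookup (tabulate (parityℤ ∘ y)) j ℙ.* lookup (lookup (residues Tᵀ) j) i)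
      ≡⟨ cong₂ ℙ._+_ (lookup-replicate i 0ℙ) (Sumℙ.sum-cong-≗ λ j →
           trans (cong₂ ℙ._*_ (lookup∘tabulate (parityℤ ∘ y) j) (lookup-residues Tᵀ j i))
             (sym (parity-* (y j) (T i j)))) ⟩
    Sumℙ.sum (λ j → parityℤ (y j ℤ.* T i j))
      ≡⟨ parity-sum (λ j → y j ℤ.* T i j) ⟨
    parityℤ (Sumℤ.sum (λ j → y j ℤ.* T i j))
      ≡⟨ cong parityℤ (y∙T≡2q i) ⟩
    parityℤ (quotient (4∣vector∙T c i) ℤ.* + 2)
      ≡⟨ parity-* (quotient (4∣vector∙T c i)) (+ 2) ⟩
    parityℤ (quotient (4∣vector∙T c i)) ℙ.* 0ℙ
      ≡⟨ ℙ.*-zeroʳ (parityℤ (quotient (4∣vector∙T c i))) ⟩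
    0ℙ ∎
    where
    y∙T≡2q : ∀ i → Sumℤ.sum (λ j → y j ℤ.* T i j) ≡ quotient (4∣vector∙T c i) ℤ.* + 2
    y∙T≡2q i with divides q v∙T≡4q ← 4∣vector∙T c i = ℤ.*-cancelˡ-≡ (+ 2) _ _ (begin
      + 2 ℤ.* Sumℤ.sum (λ j → y j ℤ.* T i j)
        ≡⟨ Sumℤ.*-distribˡ-sum (+ 2) (λ j → y j ℤ.* T i j) ⟩
      Sumℤ.sum (λ j → + 2 ℤ.* (y j ℤ.* T i j))
        ≡⟨ Sumℤ.sum-cong-≗ (λ j → trans (sym (ℤ.*-assoc (+ 2) (y j) (T i j)))
             (cong (ℤ._* T i j) (sym (v≡2y j)))) ⟩
      Sumℤ.sum (λ j → vector T c j ℤ.* T i j)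
        ≡⟨ v∙T≡4q ⟩
      q ℤ.* + 4
        ≡⟨ solve 1 (λ q → q :* con (+ 4) := con (+ 2) :* (q :* con (+ 2))) refl q ⟩
      + 2 ℤ.* (q ℤ.* + 2) ∎)
      where open ℤ-Solver.+-*-Solver

  vector-norm : ∀ c → (∀ j → vector T c j ≡ + 0) ⊎ + 16 ℤ.≤ normℤ (vector T c)
  vector-norm c = [ (λ residue≡𝟘 → even (halves (vector T c) (trans (sym (residue c)) residue≡𝟘)))
                  , (λ 16≤weight → inj₂ (ℤ.≤-trans (ℤ.+≤+ (subst (λ w → 16 ℕ.≤ weight w) (residue c) 16≤weight))
                                                   (weight≤normℤ (vector T c))))
                  ]′ (All.lookup residueWeight (combine∈span (tabulate (parityℤ ∘ c)) (residues T)))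
    where
    even : (∃[ y ] ∀ j → vector T c j ≡ + 2 ℤ.* y j) → (∀ j → vector T c j ≡ + 0) ⊎ + 16 ℤ.≤ normℤ (vector T c)
    even (y , v≡2y) = Sum.map
      (λ y≡0 j → trans (v≡2y j) (cong (+ 2 ℤ.*_) (y≡0 j)))
      (λ 4≤y² → subst (+ 16 ℤ.≤_) (sym (normℤ-double v≡2y)) (ℤ.*-monoˡ-≤-nonNeg (+ 4) 4≤y²))
      -- Either `y` is itself even, or its parities form a nonzero word of the dual code with at
      -- least 4 ones.
      ([ (λ y≡𝟘 → doubled-norm (halves y y≡𝟘))
       , (λ 4≤weight → inj₂ (ℤ.≤-trans (ℤ.+≤+ 4≤weight) (weight≤normℤ y)))
       ]′ (torsionWeight (tabulate (parityℤ ∘ y)) (syndrome c y v≡2y)))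

-- Scaling integer matrices by one half

half : ℤ → ℚ
half k = ι k ℚ.* ½

half-products : ∀ {n} (f g : Fin n → ℤ) →
  Sumℚ.sum (λ j → half (f j) ℚ.* half (g j)) ≡ ι (Sumℤ.sum (λ j → f j ℤ.* g j)) ℚ.* (½ ℚ.* ½)
half-products f g = begin
  Sumℚ.sum (λ j → half (f j) ℚ.* half (g j))
    ≡⟨ Sumℚ.sum-cong-≗ (λ j → trans
         (solve 3 (λ a b h → (a :* h) :* (b :* h) := (a :* b) :* (h :* h)) refl (ι (f j)) (ι (g j)) ½)
         (cong (ℚ._* (½ ℚ.* ½)) (sym (ι-* (f j) (g j))))) ⟩
  Sumℚ.sum (λ j → ι (f j ℤ.* g j) ℚ.* (½ ℚ.* ½))
    ≡⟨ Sumℚ.*-distribʳ-sum (½ ℚ.* ½) (λ j → ι (f j ℤ.* g j)) ⟨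
  Sumℚ.sum (λ j → ι (f j ℤ.* g j)) ℚ.* (½ ℚ.* ½)
    ≡⟨ cong (ℚ._* (½ ℚ.* ½)) (ι-sum (λ j → f j ℤ.* g j)) ⟨
  ι (Sumℤ.sum (λ j → f j ℤ.* g j)) ℚ.* (½ ℚ.* ½) ∎
  where
  open ≡-Reasoning
  open +-*-Solver

half-sum : ∀ {n} (f g : Fin n → ℤ) k → Sumℤ.sum (λ j → f j ℤ.* g j) ≡ k ℤ.* + 4 →
  Sumℚ.sum (λ j → half (f j) ℚ.* half (g j)) ≡ ι k
half-sum f g k f∙g≡4k = begin
  Sumℚ.sum (λ j → half (f j) ℚ.* half (g j))
    ≡⟨ trans (half-products f g) (cong (λ k → ι k ℚ.* (½ ℚ.* ½)) f∙g≡4k) ⟩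
  ι (k ℤ.* + 4) ℚ.* (½ ℚ.* ½)
    ≡⟨ cong (ℚ._* (½ ℚ.* ½)) (ι-* k (+ 4)) ⟩
  ι k ℚ.* ι (+ 4) ℚ.* (½ ℚ.* ½)
    -- After reassociation the closed factor `ι (+ 4) ℚ.* (½ ℚ.* ½)` evaluates to `1ℚ`.
    ≡⟨ ℚ.*-assoc (ι k) (ι (+ 4)) (½ ℚ.* ½) ⟩
  ι k ℚ.* 1ℚ
    ≡⟨ ℚ.*-identityʳ (ι k) ⟩
  ι k ∎
  where open ≡-Reasoning

-- The Gram entries of the halved lattice are quotients stored in divisibility proofs, and those
-- proofs are opaque for the concrete matrix. Their values are recovered by cancelling 4.
quotient≡ : ∀ {a} k (4∣a : + 4 ∣ a) → a ≡ k ℤ.* + 4 → quotient 4∣a ≡ k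
quotient≡ k (divides q a≡4q) a≡4k = ℤ.*-cancelʳ-≡ q k (+ 4) (trans (sym a≡4q) a≡4k)

-- `T Nᵀ = Nᵀ T = 4I` makes the rows of `½T` and `½N` dual bases, and divisibility of both Gram
-- matrices by 4 becomes integrality after halving.
module HalfLattice {n : ℕ} (T N : Fin n → Fin n → ℤ)
  (T∙N : ∀ i l → Sumℤ.sum (λ j → T i j ℤ.* N l j) ≡ Sumℤ.δ i l ℤ.* + 4)
  (NᵀT : ∀ j l → Sumℤ.sum (λ i → N i j ℤ.* T i l) ≡ Sumℤ.δ j l ℤ.* + 4)
  (T∙T : ∀ i l → + 4 ∣ Sumℤ.sum (λ j → T i j ℤ.* T l j))
  (N∙N : ∀ i l → + 4 ∣ Sumℤ.sum (λ j → N i j ℤ.* N l j))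
  where

  open RationalLattice (λ i j → half (T i j)) (λ i j → half (N i j))
    (λ i l → quotient (T∙T i l)) (λ i l → quotient (N∙N i l))
    (λ i l → trans (half-sum (T i) (N l) (Sumℤ.δ i l) (T∙N i l)) (ι-δ i l))
    (λ j l → trans (half-sum (λ i → N i j) (λ i → T i l) (Sumℤ.δ j l) (NᵀT j l)) (ι-δ j l))
    (λ i l → half-sum (T i) (T l) (quotient (T∙T i l)) (_∣_.equality (T∙T i l)))
    (λ i l → half-sum (N i) (N l) (quotient (N∙N i l)) (_∣_.equality (N∙N i l)))
    public

  point≡half : ∀ c j → point c j ≡ half (vector T c j)
  point≡half c j = begin
    Sumℚ.sum (λ i → ι (c i) ℚ.* half (T i j))
      ≡⟨ Sumℚ.sum-cong-≗ (λ i → trans (sym (ℚ.*-assoc (ι (c i)) (ι (T i j)) ½))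
           (cong (ℚ._* ½) (sym (ι-* (c i) (T i j))))) ⟩
    Sumℚ.sum (λ i → ι (c i ℤ.* T i j) ℚ.* ½)
      ≡⟨ Sumℚ.*-distribʳ-sum ½ (λ i → ι (c i ℤ.* T i j)) ⟨
    Sumℚ.sum (λ i → ι (c i ℤ.* T i j)) ℚ.* ½
      ≡⟨ cong (ℚ._* ½) (ι-sum (λ i → c i ℤ.* T i j)) ⟨
    half (vector T c j) ∎
    where open ≡-Reasoning

  halfLattice-odd : ∀ l k → normℤ (T l) ≡ (+ 1 ℤ.+ + 2 ℤ.* k) ℤ.* + 4 → ¬ Even lattice
  halfLattice-odd l k Tₗ² = odd l λ k′ q≡2k′ → 1+2k≢2k′ k k′ (trans (sym (quotient≡ _ (T∙T l l) Tₗ²)) q≡2k′)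
    where
    1+2k≢2k′ : ∀ k k′ → + 1 ℤ.+ + 2 ℤ.* k ≢ + 2 ℤ.* k′
    -- Taking parities turns the equation into `1ℙ ≡ 0ℙ`.
    1+2k≢2k′ k k′ eq with () ← trans
      (sym (trans (parity-+ (+ 1) (+ 2 ℤ.* k)) (cong (1ℙ ℙ.+_) (parity-* (+ 2) k))))
      (trans (cong parityℤ eq) (parity-* (+ 2) k′))

  halfLattice-minimumNorm : ∀ l → normℤ (T l) ≡ + 16 →
    (∀ c → (∀ j → vector T c j ≡ + 0) ⊎ + 16 ℤ.≤ normℤ (vector T c)) →
    HasMinimumNorm lattice (fromℤ (+ 4))
  halfLattice-minimumNorm l Tₗ²≡16 bound = subst (HasMinimumNorm lattice ∘ fromℤ) q≡4
    (minimumNorm l (λ q≡0 → contradiction (trans (sym q≡4) q≡0) λ ())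
      λ c → Sum.map (zero-point c) (long-point c) (bound c))
    where
    q≡4 : quotient (T∙T l l) ≡ + 4
    q≡4 = quotient≡ (+ 4) (T∙T l l) Tₗ²≡16
    zero-point : ∀ c → (∀ j → vector T c j ≡ + 0) → ∀ j → point c j ≡ 0ℚ
    zero-point c v≡0 j = trans (point≡half c j) (cong half (v≡0 j))
    long-point : ∀ c → + 16 ℤ.≤ normℤ (vector T c) →
      ι (quotient (T∙T l l)) ℚ.≤ Sumℚ.sum (λ j → point c j ℚ.* point c j)
    long-point c 16≤v² = subst₂ ℚ._≤_ (cong ι (sym q≡4))
      (sym (trans (Sumℚ.sum-cong-≗ λ j → cong₂ ℚ._*_ (point≡half c j) (point≡half c j))
                  (half-products (vector T c) (vector T c))))
      -- The left side `ι (+ 16) ℚ.* (½ ℚ.* ½)` evaluates to `ι (+ 4)`.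
      (ℚ.*-monoʳ-≤-nonNeg (½ ℚ.* ½) (ι-mono-≤ 16≤v²))

-- The code of length 41

-- A matrix row with entries in {0, 1, 2, 3} is written as a numeral, one decimal digit per entry.
digits : ∀ n → ℕ → Vec ℤ n
digits zero    m = []
digits (suc n) m = digits n (m / 10) ∷ʳ + (m % 10)

Matrix : ℕ → ℕ → Set
Matrix m n = Vec (Vec ℤ n) m

entry : ∀ {m n} → Matrix m n → Fin m → Fin n → ℤ
entry M i j = lookup (lookup M i) j

matrix : ∀ {m n} → (Fin m → Fin n → ℤ) → Matrix m n
matrix f = tabulate λ i → tabulate (f i)

scalar : ∀ n → ℤ → Matrix n n
scalar n k = matrix {n} {n} λ i j → k ℤ.* Sumℤ.δ i j

O : ∀ m n → Matrix m n
O m n = replicate m (replicate n (+ 0))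

infixr 6 _∣∣_
_∣∣_ : ∀ {l m n} → Matrix l m → Matrix l n → Matrix l (m ℕ.+ n)
_∣∣_ = zipWith _++_

-- The binary code [I X Y mod 2] was found by simulated annealing over doubly even codes; Y mod 2
-- was then lifted to make the rows of [I X Y] orthogonal modulo 4, and Z solves X + Y Zᵀ ≡ 0 modulo 2.
X : Matrix 10 21
X = map (digits 21) (
  111001101111001101110 ∷ 111100000001110011001 ∷ 101011001011011001101 ∷
  001010001110111111101 ∷ 001100101001001111010 ∷ 100101100011011010001 ∷
  010001111101110111000 ∷ 010011010111010011010 ∷ 110111100010100111010 ∷
  000101011000010000011 ∷ [])

Y : Matrix 10 10
Y = map (digits 10) (
  1011001100 ∷ 1001010110 ∷ 2311330312 ∷ 3302103013 ∷ 3002320313 ∷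
  0202113123 ∷ 3321303332 ∷ 2012001303 ∷ 1032311110 ∷ 1121112331 ∷ [])

Z : Matrix 21 10
Z = map (digits 10) (
  0111000110 ∷ 0100010110 ∷ 0111011010 ∷ 0010001010 ∷ 1011110101 ∷
  1011100000 ∷ 0110000001 ∷ 0000010011 ∷ 1110011000 ∷ 0011111001 ∷
  1010101011 ∷ 0101111101 ∷ 1000000111 ∷ 0001000110 ∷ 0111111000 ∷
  1110101010 ∷ 0110100101 ∷ 0010110000 ∷ 1100111110 ∷ 1010000101 ∷
  1011001010 ∷ [])

-- Triangular with determinant `2^21 · 4^10 = 2^41`, so `½T` has determinant 1. The choice of `Z`
-- makes the first two block rows orthogonal modulo 4, their products being `2(X + Y Zᵀ)`.
T : Matrix 41 41
T = scalar 10 (+ 1) ∣∣ X               ∣∣ Y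
 ++ O 21 10         ∣∣ scalar 21 (+ 2) ∣∣ matrix (λ i j → + 2 ℤ.* entry Z i j)
 ++ O 10 10         ∣∣ O 10 21         ∣∣ scalar 10 (+ 4)

-- N = 4 T⁻ᵀ, so that ½N is the basis dual to ½T.
N : Matrix 41 41
N = scalar 10 (+ 4)                             ∣∣ O 10 21                           ∣∣ O 10 10
 ++ matrix (λ i j → ℤ.- (+ 2) ℤ.* entry X j i)  ∣∣ scalar 21 (+ 2)                   ∣∣ O 21 10
 -- Back substitution gives `(XZ - Y)/4` as the upper right block of `T⁻¹`; here it is transposed
 -- and multiplied by 4.
 ++ matrix (λ i j → Sumℤ.sum (λ l → entry Z l i ℤ.* entry X j l) ℤ.- entry Y j i)
                                                ∣∣ matrix (λ i j → ℤ.- entry Z j i) ∣∣ scalar 10 (+ 1)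

-- Certification of the code by evaluation

dual? : ∀ {n} (A B : Matrix n n) →
  Dec (∀ i l → Sumℤ.sum (λ j → entry A i j ℤ.* entry B l j) ≡ Sumℤ.δ i l ℤ.* + 4)
dual? A B = all? λ i → all? λ l → _ ℤ.≟ _

dualᵀ? : ∀ {n} (A B : Matrix n n) →
  Dec (∀ j l → Sumℤ.sum (λ i → entry A i j ℤ.* entry B i l) ≡ Sumℤ.δ j l ℤ.* + 4)
dualᵀ? A B = all? λ j → all? λ l → _ ℤ.≟ _

integral? : ∀ {n} (A : Matrix n n) →
  Dec (∀ i l → + 4 ∣ Sumℤ.sum (λ j → entry A i j ℤ.* entry A l j))
integral? A = all? λ i → all? λ l → + 4 ∣? _

-- Sealed, so that the evaluated certificates are never unfolded again.
abstract
  T∙N : ∀ i l → Sumℤ.sum (λ j → entry T i j ℤ.* entry N l j) ≡ Sumℤ.δ i l ℤ.* + 4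
  T∙N = toWitness {a? = dual? T N} _

  NᵀT : ∀ j l → Sumℤ.sum (λ i → entry N i j ℤ.* entry T i l) ≡ Sumℤ.δ j l ℤ.* + 4
  NᵀT = toWitness {a? = dualᵀ? N T} _

  T∙T : ∀ i l → + 4 ∣ Sumℤ.sum (λ j → entry T i j ℤ.* entry T l j)
  T∙T = toWitness {a? = integral? T} _

  N∙N : ∀ i l → + 4 ∣ Sumℤ.sum (λ j → entry N i j ℤ.* entry N l j)
  N∙N = toWitness {a? = integral? N} _

  -- Only the first ten rows of `T` are nonzero modulo 2, so the list has `2^10` words.
  residueWeight : All (λ w → w ≡ 𝟘 ⊎ 16 ℕ.≤ weight w) (span (residues (entry T)))
  residueWeight = toWitness
    {a? = All.all? (λ w → w ≟ᵥ 𝟘 ⊎-dec 16 ℕ.≤? weight w) (span (residues (entry T)))} _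

  torsionWeight : ∀ w → combine 𝟘 w (residues (λ j i → entry T i j)) ≡ 𝟘 → w ≡ 𝟘 ⊎ 4 ℕ.≤ weight w
  -- For `t = 2` the bound `suc t < weight w` is `4 ≤ weight w`: modulo 2 the columns of `T` are
  -- nonzero and distinct, and no three of them sum to zero.
  torsionWeight = toWitness {a? = relationsHeavy? 2 (residues (λ j i → entry T i j))} _

module L = HalfLattice (entry T) (entry N) T∙N NᵀT T∙T N∙N

proposition2 : Σ (Lattice 41) λ L → OddUnimodular L × HasMinimumNorm L (fromℤ (+ 4))
-- The first row of `T` has norm `20 = (1 + 2 · 2) · 4`, so its half has the odd norm 5.
proposition2 = L.lattice , (L.unimodular , L.halfLattice-odd zero (+ 2) refl) ,
  -- The second row of `T` has norm 16, so its half attains the minimum 4.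
  L.halfLattice-minimumNorm (suc zero) refl (ConstructionA.vector-norm (entry T) T∙T residueWeight torsionWeight)
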